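{- Let $a,b,c,d,e$ be nonzero integers, and let $f(x)=\frac{(x+a)(x+b)(x+c)}{x}$ and $g(y)=\frac{(y+d)(y+e)(y+cd/a)}{y}$. Then the Diophantine equation $z^2=f(x)^2+g(y)^2$ or the Diophantine equation $z^2=f(x)^2-g(y)^2$ has infinitely many nontrivial rational solutions $(x,y,z)\in\mathbb{Q}^3$.
   Context: A solution $(x,y,z)$ of $z^2=f(x)^2\pm g(y)^2$ is called nontrivial if $f(x)g(y)\neq 0$ and $f(x)^2\neq g(y)^2$. -}

module Defs where

open import Data.Integer.Base using (ℤ)
open import Data.Rational.Base
  using (ℚ; 0ℚ; _+_; _*_; _-_; _÷_; _/_; ≢-nonZero)
open import Data.Rational.Properties using (_≟_)
open import Data.Product using (_×_; _,_; ∃)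
open import Data.List.Base using (List)
open import Data.List.Membership.Propositional using (_∉_)
open import Relation.Nullary using (¬_; yes; no)
open import Relation.Binary.PropositionalEquality using (_≡_; _≢_)

ι : ℤ → ℚ
ι n = n / 1

-- total division on ℚ with the convention p ⊘ 0 = 0.
-- It is only ever used with a nonzero divisor where it matters:
-- c*d/a has a ≠ 0 by hypothesis, and f(x), g(y) at x = 0 / y = 0
-- are excluded since nontrivial solutions require f(x) g(y) ≠ 0
-- (and f, g are undefined there).
_⊘_ : ℚ → ℚ → ℚ
p ⊘ q with q ≟ 0ℚ
... | yes _  = 0ℚ
... | no q≢0 = _÷_ p q {{≢-nonZero q≢0}}

fF : (a b c : ℤ) → ℚ → ℚ
fF a b c x = ((x + ι a) * (x + ι b) * (x + ι c)) ⊘ x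

gF : (a c d e : ℤ) → ℚ → ℚ
gF a c d e y = ((y + ι d) * (y + ι e) * (y + ((ι c * ι d) ⊘ ι a))) ⊘ y

sq : ℚ → ℚ
sq q = q * q

Triple : Set
Triple = ℚ × ℚ × ℚ

NontrivPlus : (ℚ → ℚ) → (ℚ → ℚ) → Triple → Set
NontrivPlus F G (x , y , z) =
  (sq z ≡ sq (F x) + sq (G y)) × (F x * G y ≢ 0ℚ) × (sq (F x) ≢ sq (G y))

NontrivMinus : (ℚ → ℚ) → (ℚ → ℚ) → Triple → Set
NontrivMinus F G (x , y , z) =
  (sq z ≡ sq (F x) - sq (G y)) × (F x * G y ≢ 0ℚ) × (sq (F x) ≢ sq (G y))

InfinitelyMany : (Triple → Set) → Set
InfinitelyMany P = (L : List Triple) → ∃ λ t → P t × t ∉ L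

{-# OPTIONS --safe #-}
module Submission where

-- Put k = d/a, so that g has the zeros −ka, −e, −kc. Along y = kx the two functions share the factor
-- (x+a)(x+c)/x and the plus equation becomes w² = (x+b)² + (k²x+ke)², a conic with a rational point.
-- It degenerates exactly when e = kb, and then g(y) = k² f(y/k). In that case let x = cs and y = kab/x:
-- with ρ = ab/c² and κ = k² the plus equation becomes the genus one quartic
--   w² = (s(s+1))² + (κ(s+ρ))².
-- Permuting a, b, c changes ρ, the three values having product 1, and exchanging x with y/k replaces κ by
-- 1/κ, so ρ and κ may be assumed to have odd denominators. The Jacobian
--   Y² = X(X² + (1+κ²)X − 4κ²ρ(ρ−1))
-- contains the point X = −1, Y = κ(2ρ−1), whose double has X = 1/ζ² with ζ even. Doubling raises the 2-adic
-- valuation of ζ by one, so the iterated doubles are distinct. The minus equation is never needed.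

open import Defs
open import Data.Integer.Base as ℤ using (ℤ; +_; 0ℤ)
import Data.Integer.Properties as ℤ
open import Data.Integer.Divisibility.Signed
open import Data.Integer.DivMod using (_%ℕ_; _/ℕ_; a≡a%ℕn+[a/ℕn]*n; n%ℕd<d)
open import Data.Integer.Tactic.RingSolver using (solve-∀)
open import Data.Nat.Base as ℕ using (ℕ; zero; suc; s≤s; z≤n)
import Data.Nat.Properties as ℕ
import Data.Nat.Divisibility as ℕ
open import Data.Nat.ListAction using (sum)
open import Data.List.Base using (List; []; _∷_; map; _++_)
open import Data.List.Membership.Propositional using (_∈_; _∉_)
open import Data.List.Membership.Propositional.Properties using (∈-map⁺; ∈-++⁺ˡ; ∈-++⁺ʳ)
open import Data.List.Relation.Unary.Any using (here; there)
open import Data.Product using (_×_; _,_; ∃; proj₁; proj₂)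
open import Data.Sum using (_⊎_; inj₁; inj₂; [_,_]′)
open import Data.Empty using (⊥; ⊥-elim; ⊥-elim-irr)
open import Function using (_∘_)
open import Relation.Nullary using (¬_; yes; no)
open import Relation.Binary.PropositionalEquality

-- Parity and divisibility by powers of two.

module Integers where

  open import Data.Integer.Base using (_+_; _*_; _-_; -_; -[1+_])

  -- The form `+ 1 + j * + 2` is the one that division with remainder returns in `parity`.
  data Odd : ℤ → Set where
    odd : ∀ j → Odd (+ 1 + j * + 2)

  parity : ∀ n → + 2 ∣ n ⊎ Odd n
  parity n with n %ℕ 2 | n /ℕ 2 | a≡a%ℕn+[a/ℕn]*n n 2 | n%ℕd<d n 2
  ... | 0 | j | eq | _ = inj₁ (divides j (trans eq (ℤ.+-identityˡ _)))
  ... | 1 | j | eq | _ = inj₂ (subst Odd (sym eq) (odd j))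
  ... | suc (suc _) | _ | _ | s≤s (s≤s ())

  odd⇒¬even : ∀ {n} → Odd n → ¬ (+ 2 ∣ n)
  odd⇒¬even (odd j) 2∣n with ∣⇒∣ᵤ (∣m+n∣n⇒∣m {+ 2} {+ 1} {j * + 2} 2∣n (divides j refl))
  ... | 2∣1 with ℕ.∣⇒≤ 2∣1
  ... | s≤s ()

  odd≢0 : ∀ {n} → Odd n → n ≢ 0ℤ
  odd≢0 o refl = odd⇒¬even o (divides 0ℤ refl)

  odd-* : ∀ {m n} → Odd m → Odd n → Odd (m * n)
  odd-* (odd i) (odd j) = subst Odd (eq i j) (odd (i + j + + 2 * i * j))
    where
    eq : ∀ i j → + 1 + (i + j + + 2 * i * j) * + 2
               ≡ (+ 1 + i * + 2) * (+ 1 + j * + 2)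
    eq = solve-∀

  odd+even : ∀ {m n} → Odd m → + 2 ∣ n → Odd (m + n)
  odd+even (odd i) (divides j refl) = subst Odd (eq i j) (odd (i + j))
    where
    eq : ∀ i j → + 1 + (i + j) * + 2 ≡ (+ 1 + i * + 2) + j * + 2
    eq = solve-∀

  even+odd : ∀ {m n} → + 2 ∣ m → Odd n → Odd (m + n)
  even+odd {m} {n} e o = subst Odd (ℤ.+-comm n m) (odd+even o e)

  odd-even : ∀ {m n} → Odd m → + 2 ∣ n → Odd (m - n)
  odd-even o e = odd+even o (∣m⇒∣-m e)

  pow2 : ℕ → ℤ
  pow2 n = + (2 ℕ.^ n)

  pow2-suc : ∀ n → pow2 (suc n) ≡ + 2 * pow2 n
  pow2-suc n = ℤ.pos-* 2 (2 ℕ.^ n)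

  pow2-suc-even : ∀ n → + 2 ∣ pow2 (suc n)
  pow2-suc-even n = divides (pow2 n) (trans (pow2-suc n) (ℤ.*-comm (+ 2) (pow2 n)))

  pow2∣pow2-suc : ∀ n → pow2 n ∣ pow2 (suc n)
  pow2∣pow2-suc n = divides (+ 2) (pow2-suc n)

  ∣-pow2-suc : ∀ {m n} k → + 2 ∣ m → pow2 k ∣ n → pow2 (suc k) ∣ m * n
  ∣-pow2-suc k (divides i refl) (divides j refl) =
    divides (i * j) (trans (eq i j (pow2 k)) (cong (i * j *_) (sym (pow2-suc k))))
    where
    eq : ∀ i j q → i * + 2 * (j * q) ≡ i * j * (+ 2 * q)
    eq = solve-∀

  n<2^n : ∀ n → n ℕ.< 2 ℕ.^ n
  n<2^n zero = s≤s z≤n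
  n<2^n (suc n) = ℕ.+-mono-≤ (ℕ.≤-trans (s≤s z≤n) (n<2^n n)) (ℕ.≤-trans (n<2^n n) (ℕ.m≤m+n _ 0))

  -- Induction on `k`: an odd `n` would make `m * n` odd, so `n` is even and one factor 2 can be
  -- removed from both sides.
  odd-cancel-pow2 : ∀ {m} → Odd m → ∀ k n → pow2 k ∣ m * n → pow2 k ∣ n
  odd-cancel-pow2 o zero n _ = divides n (sym (ℤ.*-identityʳ n))
  odd-cancel-pow2 {m} o (suc k) n d with parity n
  ... | inj₂ odd-n = ⊥-elim (odd⇒¬even (odd-* o odd-n) (∣-trans (pow2-suc-even k) d))
  ... | inj₁ (divides j refl) = subst (pow2 (suc k) ∣_) (ℤ.*-comm (+ 2) j)
          (∣-pow2-suc k ∣-refl (odd-cancel-pow2 o k j (halve d)))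
    where
    halve : pow2 (suc k) ∣ m * (j * + 2) → pow2 k ∣ m * j
    halve (divides q eq) = divides q (ℤ.*-cancelʳ-≡ (m * j) (q * pow2 k) (+ 2)
      (trans (ℤ.*-assoc m j (+ 2)) (trans eq (trans
        (cong (q *_) (trans (pow2-suc k) (ℤ.*-comm (+ 2) (pow2 k))))
        (sym (ℤ.*-assoc q (pow2 k) (+ 2)))))))

  ≢0-* : ∀ {m n} → m ≢ 0ℤ → n ≢ 0ℤ → m * n ≢ 0ℤ
  ≢0-* {m} m≢0 n≢0 eq = [ m≢0 , n≢0 ]′ (ℤ.i*j≡0⇒i≡0∨j≡0 m eq)

  -- Doubling on the Jacobi quartic.

  -- (p, r, h) stands for the point ζ = p/r, η = h/r² of the Jacobi quartic η² = 1 + Aζ² + Bζ⁴.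
  record Point (A B : ℤ) (n : ℕ) : Set where
    field
      p r h : ℤ
      p≢0   : p ≢ 0ℤ
      2ⁿ∣p  : pow2 (suc n) ∣ p
      r-odd : Odd r
      h-odd : Odd h
      curve : h * h ≡ r * r * (r * r) + A * (p * p) * (r * r) + B * (p * p * (p * p))

    p-even : + 2 ∣ p
    p-even = ∣-trans (pow2-suc-even n) 2ⁿ∣p

  -- The duplication formula ζ ↦ 2ζη/(1 − Bζ⁴).
  double : ∀ {A B n} → Point A B n → Point A B (suc n)
  double {A} {B} {n} P = record
    { p = + 2 * (h * r * p)
    ; r = r′
    -- The numerator of η is split so that its oddness follows from that of `r′`.
    ; h = r′ * r′ + + 2 * g
    ; p≢0 = ≢0-* {+ 2} (λ ()) (≢0-* (≢0-* (odd≢0 h-odd) (odd≢0 r-odd)) p≢0)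
    ; 2ⁿ∣p = ∣-pow2-suc (suc n) ∣-refl (∣n⇒∣m*n (h * r) 2ⁿ∣p)
    ; r-odd = r′-odd
    ; h-odd = odd+even (odd-* r′-odd r′-odd) (∣m⇒∣m*n g ∣-refl)
    -- `quartic-double` is an identity in p² and r² in which the quartic polynomial stands for h².
    -- `curve` puts h² back, and `square` then exhibits the square of the new `p`.
    ; curve = trans (quartic-double A B (p * p) (r * r))
        (trans (cong (λ q → rhs (+ 4 * q * (p * p) * (r * r))) (sym curve))
          (cong rhs (square h r p)))
    }
    where
    open Point P
    r′ = r * r * (r * r) - B * (p * p * (p * p))
    g = A * (r * r) * (p * p) * (r * r * (r * r) + B * (p * p * (p * p)))
          + + 4 * (B * (r * r * (r * r)) * (p * p * (p * p)))
    rhs : ℤ → ℤ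
    rhs q = r′ * r′ * (r′ * r′) + A * q * (r′ * r′) + B * (q * q)

    r′-odd : Odd r′
    r′-odd = odd-even (odd-* (odd-* r-odd r-odd) (odd-* r-odd r-odd))
               (∣n⇒∣m*n B (∣m⇒∣m*n (p * p) (∣m⇒∣m*n p p-even)))

    square : ∀ h r p → + 4 * (h * h) * (p * p) * (r * r) ≡ + 2 * (h * r * p) * (+ 2 * (h * r * p))
    square = solve-∀

    quartic-double : ∀ A B P R →
      let q = R * R + A * P * R + B * (P * P)
          s = R * R - B * (P * P)
          t = s * s + + 2 * (A * R * P * (R * R + B * (P * P)) + + 4 * (B * (R * R) * (P * P)))
          u = + 4 * q * P * R
      in t * t ≡ s * s * (s * s) + A * u * (s * s) + B * (u * u)
    quartic-double = solve-∀

  -- Integer solutions of the homogenised genus one quartic.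

  -- With κ = M/D and ρ = R/S, the coordinate X of the Jacobian is multiplied by (DS)² to make A and B integral.
  module _ (M D R S : ℤ) where

    A B : ℤ
    A = (D * D + M * M) * (S * S)
    B = - (+ 4 * (M * M * (D * D) * (S * S) * (R * (R - S))))

    -- s = W/V and w = Z/(DSV²), in the notation of the header.
    record Solution (n : ℕ) : Set where
      field
        V W Z : ℤ
        V≢0   : V ≢ 0ℤ
        2ⁿ∣V  : pow2 n ∣ V
        W-odd : Odd W
        pythagoras : Z * Z ≡ D * S * W * (W + V) * (D * S * W * (W + V))
                           + M * V * (S * W + R * V) * (M * V * (S * W + R * V))

    module _ (M≢0 : M ≢ 0ℤ) (D-odd : Odd D) (S-odd : Odd S) where

      -- The starting point is the double of (X, Y) = (−(DS)², D²S²M(2R−S)), with ζ = 2Y/(X² − B).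
      points : ∀ n → Point A B n
      points (suc n) = double (points n)
      points zero = record
        -- This is ζ = 2Y/(X² - B) with the common factor D²S² cancelled.
        { p = + 2 * M * (+ 2 * R - S)
        ; r = d * s + + 4 * m * T
        ; h = d * s * (d * s) + + 2 * h₁
        -- `2R − S` is odd because `S` is, so Y ≠ 0 and the base point does not have order two.
        ; p≢0 = ≢0-* (≢0-* {+ 2} (λ ()) M≢0) (odd≢0 (even+odd (∣m⇒∣m*n R ∣-refl) (odd-neg S-odd)))
        ; 2ⁿ∣p = ∣m⇒∣m*n (+ 2 * R - S) (∣m⇒∣m*n M ∣-refl)
        ; r-odd = odd+even ds-odd (∣m⇒∣m*n T (∣m⇒∣m*n m (divides (+ 2) refl)))
        ; h-odd = odd+even (odd-* ds-odd ds-odd) (∣m⇒∣m*n h₁ ∣-refl)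
        -- The check is polynomial in D², M², S² and R(R - S), because (2R - S)² = S² + 4R(R - S).
        ; curve = trans (base-point d m s T)
            (cong (λ u → r * r * (r * r) + A * u * (r * r) + B * (u * u)) (square M R S))
        }
        where
        d = D * D
        m = M * M
        s = S * S
        T = R * (R - S)
        r = d * s + + 4 * m * T
        h₁ = + 4 * (d + m) * m * s * T + + 8 * (m * m) * (T * T)
               - (d + m) * d * (s * s) - + 12 * m * d * s * T
        ds-odd : Odd (d * s)
        ds-odd = odd-* (odd-* D-odd D-odd) (odd-* S-odd S-odd)
        odd-neg : ∀ {n} → Odd n → Odd (- n)
        odd-neg (odd j) = subst Odd (eq j) (odd (- j - + 1))
          where
          eq : ∀ j → + 1 + (- j - + 1) * + 2 ≡ - (+ 1 + j * + 2)
          eq = solve-∀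
        square : ∀ M R S → + 4 * (M * M) * (S * S + + 4 * (R * (R - S)))
                   ≡ + 2 * M * (+ 2 * R - S) * (+ 2 * M * (+ 2 * R - S))
        square = solve-∀
        base-point : ∀ d m s T →
          let A = (d + m) * s
              B = - (+ 4 * (m * d * s * T))
              r = d * s + + 4 * m * T
              h = d * s * (d * s) + + 2 * (+ 4 * (d + m) * m * s * T + + 8 * (m * m) * (T * T)
                    - (d + m) * d * (s * s) - + 12 * m * d * s * T)
              u = + 4 * m * (s + + 4 * T)
          in h * h ≡ r * r * (r * r) + A * u * (r * r) + B * (u * u)
        base-point = solve-∀

      -- Substituting w = s² + s − r²/(2D²S²p²) makes the quartic a quadratic equation in s, which has the
      -- rational root W/V; clearing denominators and dividing by G gives W² below.
      solutions : ∀ n → Solution n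
      solutions n = record
        { V = V ; W = W
        -- The substitution for w multiplied by DSV², where V² = 4D²S²p²G².
        ; Z = D * S * (W * W + W * V - + 2 * (r * r) * (G * G))
        ; V≢0 = ≢0-* (≢0-* (≢0-* { -[1+ 1 ]} (λ ()) (odd≢0 (odd-* D-odd S-odd))) p≢0) (odd≢0 G-odd)
        ; 2ⁿ∣V = ∣m⇒∣m*n G (∣n⇒∣m*n (- (+ 2) * (D * S)) (∣-trans (pow2∣pow2-suc n) 2ⁿ∣p))
        ; W-odd = even+odd (∣m⇒∣m*n _ (∣n⇒∣m*n (D * S) p-even)) (odd-* h-odd r-odd)
        -- For arbitrary `W` the identity holds up to a multiple of 2αW + K - W², which vanishes by
        -- `W²`.
        ; pythagoras = trans (pythagoras-mod M D R S p (r * r) W)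
            (trans (cong (λ q → X² + + 4 * (D * S) * (D * S) * (G * G * G) * (q - W * W)) (sym W²))
              (trans (cong (λ q → X² + + 4 * (D * S) * (D * S) * (G * G * G) * q) (ℤ.+-inverseʳ (W * W)))
                (trans (cong (_+_ X²) (ℤ.*-zeroʳ (+ 4 * (D * S) * (D * S) * (G * G * G)))) (ℤ.+-identityʳ X²))))
        }
        where
        open Point (points n)
        G = r * r + M * M * (S * S) * (p * p)
        α = D * S * p * (r * r + + 2 * (M * M * (R * S) * (p * p)))
        V = - (+ 2) * (D * S) * p * G
        W = α + h * r
        G-odd : Odd G
        G-odd = odd+even (odd-* r-odd r-odd) (∣n⇒∣m*n (M * M * (S * S)) (∣m⇒∣m*n p p-even))

        X² = D * S * W * (W + V) * (D * S * W * (W + V)) + M * V * (S * W + R * V) * (M * V * (S * W + R * V))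
        K = (r * r * (r * r) - + 4 * (M * M * (R * R) * (D * D) * (S * S) * (p * p * (p * p)))) * G

        -- `W` is the root α + hr of t² = 2αt + K: the equation of the quartic gives α² + K = (hr)².
        W² : W * W ≡ + 2 * α * W + K
        W² = trans (expand α (h * r)) (cong (λ q → + 2 * α * W + q)
          (trans (cong (λ q → q - α * α) (trans (square h r) (cong (_* (r * r)) curve))) (minor M D R S p r)))
          where
          expand : ∀ α y → (α + y) * (α + y) ≡ + 2 * α * (α + y) + (y * y - α * α)
          expand = solve-∀
          square : ∀ h r → h * r * (h * r) ≡ h * h * (r * r)
          square = solve-∀
          minor : ∀ M D R S p r →
            let α = D * S * p * (r * r + + 2 * (M * M * (R * S) * (p * p)))
            in (r * r * (r * r) + (D * D + M * M) * (S * S) * (p * p) * (r * r)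
                  + - (+ 4 * (M * M * (D * D) * (S * S) * (R * (R - S)))) * (p * p * (p * p))) * (r * r) - α * α
               ≡ (r * r * (r * r) - + 4 * (M * M * (R * R) * (D * D) * (S * S) * (p * p * (p * p))))
                   * (r * r + M * M * (S * S) * (p * p))
          minor = solve-∀

        pythagoras-mod : ∀ M D R S p r² W →
          let G = r² + M * M * (S * S) * (p * p)
              α = D * S * p * (r² + + 2 * (M * M * (R * S) * (p * p)))
              V = - + 2 * (D * S) * p * G
              Z = D * S * (W * W + W * V - + 2 * r² * (G * G))
              K = (r² * r² - + 4 * (M * M * (R * R) * (D * D) * (S * S) * (p * p * (p * p)))) * G
          in Z * Z ≡ D * S * W * (W + V) * (D * S * W * (W + V)) + M * V * (S * W + R * V) * (M * V * (S * W + R * V))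
                       + + 4 * (D * S) * (D * S) * (G * G * G) * (+ 2 * α * W + K - W * W)
        pythagoras-mod = solve-∀

-- Integers inside ℚ, numerators and denominators.

open Integers
open import Data.Rational.Base using (ℚ; mkℚ; 0ℚ; 1ℚ; ↥_; ↧_; ↧ₙ_; toℚᵘ; _+_; _*_; _-_; -_; ≢-nonZero)
import Data.Rational.Properties as ℚ
open import Data.Rational.Unnormalised.Base as ℚᵘ using (mkℚᵘ; *≡*)
import Data.Rational.Unnormalised.Properties as ℚᵘ
open import Data.Rational.Solver using (module +-*-Solver)
open +-*-Solver using (solve; con; _:+_; _:*_; _:-_; :-_; _:=_)
open ≡-Reasoning

-- `ι` reduces by a gcd, which is stuck on a variable `n`; the laws for `ι` are therefore checked on
-- unnormalised representatives.
ι-≃ : ∀ n → toℚᵘ (ι n) ℚᵘ.≃ mkℚᵘ n 0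
ι-≃ n = ℚ.toℚᵘ-fromℚᵘ (mkℚᵘ n 0)

ι-injective : ∀ {m n} → ι m ≡ ι n → m ≡ n
ι-injective {m} {n} eq with ℚᵘ.≃-trans (ℚᵘ.≃-sym (ι-≃ m)) (ℚᵘ.≃-trans (ℚ.toℚᵘ-cong eq) (ι-≃ n))
... | *≡* e = trans (sym (ℤ.*-identityʳ m)) (trans e (ℤ.*-identityʳ n))

ι≢0 : ∀ {n} → n ≢ 0ℤ → ι n ≢ 0ℚ
ι≢0 n≢0 eq = n≢0 (ι-injective eq)

ι-* : ∀ m n → ι (m ℤ.* n) ≡ ι m * ι n
ι-* m n = ℚ.toℚᵘ-injective (ℚᵘ.≃-trans (ι-≃ (m ℤ.* n)) (ℚᵘ.≃-sym
  (ℚᵘ.≃-trans (ℚ.toℚᵘ-homo-* (ι m) (ι n)) (ℚᵘ.*-cong (ι-≃ m) (ι-≃ n)))))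

ι-+ : ∀ m n → ι (m ℤ.+ n) ≡ ι m + ι n
ι-+ m n = ℚ.toℚᵘ-injective (ℚᵘ.≃-trans (ι-≃ (m ℤ.+ n)) (ℚᵘ.≃-sym
  (ℚᵘ.≃-trans (ℚ.toℚᵘ-homo-+ (ι m) (ι n)) (ℚᵘ.≃-trans (ℚᵘ.+-cong (ι-≃ m) (ι-≃ n))
    (*≡* (cong (ℤ._* + 1) (cong₂ ℤ._+_ (ℤ.*-identityʳ m) (ℤ.*-identityʳ n))))))))

p*↧p≡↥p : ∀ p → p * ι (↧ p) ≡ ι (↥ p)
p*↧p≡↥p p@(mkℚ n d-1 _) = ℚ.toℚᵘ-injective (ℚᵘ.≃-trans (ℚ.toℚᵘ-homo-* p (ι (↧ p)))
  (ℚᵘ.≃-trans (ℚᵘ.*-congˡ {toℚᵘ p} (ι-≃ (↧ p))) (ℚᵘ.≃-trans (*≡* (eq n (↧ p))) (ℚᵘ.≃-sym (ι-≃ n)))))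
  where
  eq : ∀ n d → n ℤ.* d ℤ.* + 1 ≡ n ℤ.* (d ℤ.* + 1)
  eq n d = ℤ.*-assoc n d (+ 1)

cross-multiply : ∀ {p m n} → p * ι n ≡ ι m → ↥ p ℤ.* n ≡ m ℤ.* ↧ p
cross-multiply {p} {m} {n} eq = ι-injective (begin
  ι (↥ p ℤ.* n)          ≡⟨ ι-* (↥ p) n ⟩
  ι (↥ p) * ι n          ≡⟨ cong (_* ι n) (p*↧p≡↥p p) ⟨
  p * ι (↧ p) * ι n      ≡⟨ ℚ.*-assoc p (ι (↧ p)) (ι n) ⟩
  p * (ι (↧ p) * ι n)    ≡⟨ cong (p *_) (ℚ.*-comm (ι (↧ p)) (ι n)) ⟩
  p * (ι n * ι (↧ p))    ≡⟨ ℚ.*-assoc p (ι n) (ι (↧ p)) ⟨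
  p * ι n * ι (↧ p)      ≡⟨ cong (_* ι (↧ p)) eq ⟩
  ι m * ι (↧ p)          ≡⟨ ι-* m (↧ p) ⟨
  ι (m ℤ.* ↧ p)          ∎)

-- Cross-multiplying gives `↥ p * n ≡ m * ↧ p`, and the odd factor `m` cancels.
pow2∣denominator : ∀ k {p m n} → p * ι n ≡ ι m → Odd m → pow2 k ∣ n → pow2 k ∣ ↧ p
pow2∣denominator k {p} {m} {n} eq o d = odd-cancel-pow2 o k (↧ p)
  (subst (pow2 k ∣_) (cross-multiply {p} {m} {n} eq) (∣n⇒∣m*n (↥ p) d))

numerator-or-denominator-odd : ∀ p → Odd (↥ p) ⊎ Odd (↧ p)
numerator-or-denominator-odd p with parity (↥ p) | parity (↧ p)
... | inj₂ o | _ = inj₁ o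
... | _ | inj₂ o = inj₂ o
... | inj₁ e | inj₁ e′ = ⊥-elim (¬both-even p e e′)
  where
  ¬both-even : ∀ p → + 2 ∣ ↥ p → + 2 ∣ ↧ p → ⊥
  -- The coprimality proof in a rational is irrelevant, so the contradiction is eliminated
  -- irrelevantly too.
  ¬both-even (mkℚ n d-1 coprime) e e′ = ⊥-elim-irr (2≢1 (coprime (∣⇒∣ᵤ e , ∣⇒∣ᵤ e′)))
    where
    2≢1 : 2 ≡ 1 → ⊥
    2≢1 ()

-- Let `N` be the sum of the denominators in `L`. The denominator of `f N` is at least 2ᴺ > N, hence
-- larger than that of any member of `L`.
escape : (f : ℕ → ℚ) → (∀ n → pow2 n ∣ ↧ (f n)) → ∀ L → ∃ λ n → f n ∉ L
escape f d L = N , λ fN∈L → ℕ.<-irrefl refl (ℕ.≤-trans (n<2^n N)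
    (ℕ.≤-trans (ℕ.∣⇒≤ (∣⇒∣ᵤ (d N))) (denominator≤sum fN∈L)))
  where
  N : ℕ
  N = sum (map ↧ₙ_ L)
  denominator≤sum : ∀ {p L} → p ∈ L → ↧ₙ p ℕ.≤ sum (map ↧ₙ_ L)
  denominator≤sum (here refl) = ℕ.m≤m+n _ _
  denominator≤sum (there {x = x} p∈L) = ℕ.≤-trans (denominator≤sum p∈L) (ℕ.m≤n+m _ (↧ₙ x))

-- Division and cancellation in ℚ.

⊘-* : ∀ p {q} → q ≢ 0ℚ → (p ⊘ q) * q ≡ p
⊘-* p {q} q≢0 with q ℚ.≟ 0ℚ
... | yes q≡0 = ⊥-elim (q≢0 q≡0)
... | no  q≢0′ = trans (ℚ.*-assoc p _ q)
        (trans (cong (p *_) (ℚ.*-inverseˡ q {{≢-nonZero q≢0′}})) (ℚ.*-identityʳ p))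

*-cancelʳ : ∀ p q {r} → r ≢ 0ℚ → p * r ≡ q * r → p ≡ q
*-cancelʳ p q {r} r≢0 eq = trans (sym (undo p)) (trans (cong (_* (1ℚ ⊘ r)) eq) (undo q))
  where
  undo : ∀ t → t * r * (1ℚ ⊘ r) ≡ t
  undo t = begin
    t * r * (1ℚ ⊘ r)    ≡⟨ ℚ.*-assoc t r _ ⟩
    t * (r * (1ℚ ⊘ r))  ≡⟨ cong (t *_) (trans (ℚ.*-comm r _) (⊘-* 1ℚ r≢0)) ⟩
    t * 1ℚ              ≡⟨ ℚ.*-identityʳ t ⟩
    t                   ∎

⊘-unique : ∀ p q r → q ≢ 0ℚ → r * q ≡ p → r ≡ p ⊘ q
⊘-unique p q r q≢0 eq = *-cancelʳ r (p ⊘ q) q≢0 (trans eq (sym (⊘-* p q≢0)))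

*-≢0 : ∀ {p q} → p ≢ 0ℚ → q ≢ 0ℚ → p * q ≢ 0ℚ
*-≢0 {p} {q} p≢0 q≢0 eq = p≢0 (*-cancelʳ p 0ℚ q≢0 (trans eq (sym (ℚ.*-zeroˡ q))))

+-≢0 : ∀ p q → p ≢ - q → p + q ≢ 0ℚ
+-≢0 p q p≢-q eq = p≢-q (trans (solve 2 (λ p q → p := (p :+ q) :+ (:- q)) refl p q)
  (trans (cong (_+ (- q)) eq) (ℚ.+-identityˡ (- q))))

factor-≢0 : ∀ p q {r} → p * q ≡ r → r ≢ 0ℚ → p ≢ 0ℚ
factor-≢0 p q eq r≢0 refl = r≢0 (trans (sym eq) (ℚ.*-zeroˡ q))

-- Sums of two rational squares.

sq-* : ∀ p q → sq (p * q) ≡ sq p * sq q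
sq-* = solve 2 (λ p q → p :* q :* (p :* q) := p :* p :* (q :* q)) refl

sq-scale : ∀ z x y c → sq z ≡ sq x + sq y → sq (c * z) ≡ sq (c * x) + sq (c * y)
sq-scale z x y c eq = begin
  sq (c * z)                ≡⟨ sq-* c z ⟩
  sq c * sq z               ≡⟨ cong (sq c *_) eq ⟩
  sq c * (sq x + sq y)      ≡⟨ ℚ.*-distribˡ-+ (sq c) (sq x) (sq y) ⟩
  sq c * sq x + sq c * sq y ≡⟨ cong₂ _+_ (sq-* c x) (sq-* c y) ⟨
  sq (c * x) + sq (c * y)   ∎

sq-unscale : ∀ z x y c → c ≢ 0ℚ → sq (c * z) ≡ sq (c * x) + sq (c * y) → sq z ≡ sq x + sq y
sq-unscale z x y c c≢0 eq = *-cancelʳ (sq z) (sq x + sq y) (*-≢0 c≢0 c≢0) (begin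
  sq z * sq c               ≡⟨ ℚ.*-comm (sq z) (sq c) ⟩
  sq c * sq z               ≡⟨ sq-* c z ⟨
  sq (c * z)                ≡⟨ eq ⟩
  sq (c * x) + sq (c * y)   ≡⟨ cong₂ _+_ (sq-* c x) (sq-* c y) ⟩
  sq c * sq x + sq c * sq y ≡⟨ ℚ.*-distribˡ-+ (sq c) (sq x) (sq y) ⟨
  sq c * (sq x + sq y)      ≡⟨ ℚ.*-comm (sq c) _ ⟩
  (sq x + sq y) * sq c      ∎)

-- Irrationality of √2: in lowest terms p² = 2q² makes p even, and then q even as well.
sq≢1+1 : ∀ r → sq r ≢ 1ℚ + 1ℚ
sq≢1+1 r eq = no-parity (parity p)
  where
  p q : ℤ
  p = ↥ r
  q = ↧ r

  p²≡q²*2 : p ℤ.* p ≡ q ℤ.* q ℤ.* + 2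
  p²≡q²*2 = ι-injective (begin
    ι (p ℤ.* p)               ≡⟨ ι-* p p ⟩
    sq (ι p)                  ≡⟨ cong sq (p*↧p≡↥p r) ⟨
    sq (r * ι q)              ≡⟨ sq-* r (ι q) ⟩
    sq r * sq (ι q)           ≡⟨ cong (_* sq (ι q)) eq ⟩
    (1ℚ + 1ℚ) * sq (ι q)      ≡⟨ ℚ.*-comm (1ℚ + 1ℚ) (sq (ι q)) ⟩
    sq (ι q) * ι (+ 2)        ≡⟨ cong (_* ι (+ 2)) (ι-* q q) ⟨
    ι (q ℤ.* q) * ι (+ 2)     ≡⟨ ι-* (q ℤ.* q) (+ 2) ⟨
    ι (q ℤ.* q ℤ.* + 2)       ∎)

  no-parity : + 2 ∣ p ⊎ Odd p → ⊥
  no-parity (inj₂ p-odd) = odd⇒¬even (odd-* p-odd p-odd) (divides (q ℤ.* q) p²≡q²*2)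
  no-parity (inj₁ (divides j p≡j*2)) with numerator-or-denominator-odd r
  ... | inj₁ p-odd = odd⇒¬even p-odd (divides j p≡j*2)
  ... | inj₂ q-odd = odd⇒¬even (odd-* q-odd q-odd) (divides (j ℤ.* j)
          (ℤ.*-cancelʳ-≡ (q ℤ.* q) (j ℤ.* j ℤ.* + 2) (+ 2) (begin
            q ℤ.* q ℤ.* + 2              ≡⟨ p²≡q²*2 ⟨
            p ℤ.* p                      ≡⟨ cong (λ t → t ℤ.* t) p≡j*2 ⟩
            j ℤ.* + 2 ℤ.* (j ℤ.* + 2)    ≡⟨ ring j ⟩
            j ℤ.* j ℤ.* + 2 ℤ.* + 2      ∎)))
    where
    ring : ∀ j → j ℤ.* + 2 ℤ.* (j ℤ.* + 2) ≡ j ℤ.* j ℤ.* + 2 ℤ.* + 2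
    ring = solve-∀

-- This makes the condition f(x)² ≠ g(y)² automatic.
pythagorean-legs-differ : ∀ x y z → x ≢ 0ℚ → sq z ≡ sq x + sq y → sq x ≢ sq y
-- Equal legs would give (z/x)² = 2.
pythagorean-legs-differ x y z x≢0 eq x²≡y² = sq≢1+1 (z ⊘ x)
  (*-cancelʳ (sq (z ⊘ x)) (1ℚ + 1ℚ) (*-≢0 x≢0 x≢0) (begin
    sq (z ⊘ x) * sq x  ≡⟨ sq-* (z ⊘ x) x ⟨
    sq ((z ⊘ x) * x)   ≡⟨ cong sq (⊘-* z x≢0) ⟩
    sq z               ≡⟨ eq ⟩
    sq x + sq y        ≡⟨ cong (λ t → sq x + t) x²≡y² ⟨
    sq x + sq x        ≡⟨ solve 1 (λ t → t :+ t := (con 1ℚ :+ con 1ℚ) :* t) refl (sq x) ⟩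
    (1ℚ + 1ℚ) * sq x   ∎))

-- If all three denominators were even, all numerators would be odd; but the product of the
-- numerators equals that of the denominators.
odd-denominator : ∀ {p q r} → p * q * r ≡ 1ℚ → Odd (↧ p) ⊎ Odd (↧ q) ⊎ Odd (↧ r)
odd-denominator {p} {q} {r} eq
  with parity (↧ p) | numerator-or-denominator-odd p
     | parity (↧ q) | numerator-or-denominator-odd q
     | parity (↧ r) | numerator-or-denominator-odd r
... | inj₂ o | _ | _ | _ | _ | _ = inj₁ o
... | _ | inj₂ o | _ | _ | _ | _ = inj₁ o
... | _ | _ | inj₂ o | _ | _ | _ = inj₂ (inj₁ o)
... | _ | _ | _ | inj₂ o | _ | _ = inj₂ (inj₁ o)
... | _ | _ | _ | _ | inj₂ o | _ = inj₂ (inj₂ o)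
... | _ | _ | _ | _ | _ | inj₂ o = inj₂ (inj₂ o)
... | inj₁ e | inj₁ o₁ | _ | inj₁ o₂ | _ | inj₁ o₃ = ⊥-elim
      (odd⇒¬even (odd-* (odd-* o₁ o₂) o₃)
        (subst (+ 2 ∣_) (sym numerators) (∣m⇒∣m*n (↧ r) (∣m⇒∣m*n (↧ q) e))))
  where
  ι-*₃ : ∀ l m n → ι (l ℤ.* m ℤ.* n) ≡ ι l * ι m * ι n
  ι-*₃ l m n = trans (ι-* (l ℤ.* m) n) (cong (_* ι n) (ι-* l m))
  numerators : ↥ p ℤ.* ↥ q ℤ.* ↥ r ≡ ↧ p ℤ.* ↧ q ℤ.* ↧ r
  numerators = ι-injective (begin
    ι (↥ p ℤ.* ↥ q ℤ.* ↥ r)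
      ≡⟨ ι-*₃ (↥ p) (↥ q) (↥ r) ⟩
    ι (↥ p) * ι (↥ q) * ι (↥ r)
      ≡⟨ cong₂ _*_ (cong₂ _*_ (p*↧p≡↥p p) (p*↧p≡↥p q)) (p*↧p≡↥p r) ⟨
    p * ι (↧ p) * (q * ι (↧ q)) * (r * ι (↧ r))
      ≡⟨ solve 6 (λ p q r a b c → p :* a :* (q :* b) :* (r :* c) := p :* q :* r :* (a :* b :* c))
           refl p q r (ι (↧ p)) (ι (↧ q)) (ι (↧ r)) ⟩
    p * q * r * (ι (↧ p) * ι (↧ q) * ι (↧ r))
      ≡⟨ trans (cong (_* (ι (↧ p) * ι (↧ q) * ι (↧ r))) eq) (ℚ.*-identityˡ _) ⟩
    ι (↧ p) * ι (↧ q) * ι (↧ r)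
      ≡⟨ ι-*₃ (↧ p) (↧ q) (↧ r) ⟨
    ι (↧ p ℤ.* ↧ q ℤ.* ↧ r) ∎)

-- Rational points on the quartic.

ι↧≢0 : ∀ p → ι (↧ p) ≢ 0ℚ
ι↧≢0 p = ι≢0 {↧ p} (λ ())

-- Both legs and the hypotenuse are divided by `E`, which is DSV².
dehomogenise : ∀ κ ρ s V W Z → ι V ≢ 0ℚ → s * ι V ≡ ι W →
  let M = ↥ κ ; D = ↧ κ ; R = ↥ ρ ; S = ↧ ρ
      X = D ℤ.* S ℤ.* W ℤ.* (W ℤ.+ V)
      Y = M ℤ.* V ℤ.* (S ℤ.* W ℤ.+ R ℤ.* V)
  in Z ℤ.* Z ≡ X ℤ.* X ℤ.+ Y ℤ.* Y →
  ∃ λ w → sq w ≡ sq (s * (s + 1ℚ)) + sq (κ * (s + ρ))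
dehomogenise κ ρ s V W Z V≢0 sV≡W pythagoras = ι Z ⊘ E ,
  sq-unscale (ι Z ⊘ E) (s * (s + 1ℚ)) (κ * (s + ρ)) E E≢0 (begin
    sq (E * (ι Z ⊘ E))        ≡⟨ cong sq (trans (ℚ.*-comm E _) (⊘-* (ι Z) E≢0)) ⟩
    sq (ι Z)                  ≡⟨ ι-* Z Z ⟨
    ι (Z ℤ.* Z)               ≡⟨ cong ι pythagoras ⟩
    ι (X ℤ.* X ℤ.+ Y ℤ.* Y)   ≡⟨ trans (ι-+ (X ℤ.* X) (Y ℤ.* Y)) (cong₂ _+_ (ι-* X X) (ι-* Y Y)) ⟩
    sq (ι X) + sq (ι Y)       ≡⟨ cong₂ (λ x y → sq x + sq y) ιX ιY ⟩
    sq (E * (s * (s + 1ℚ))) + sq (E * (κ * (s + ρ)))  ∎)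
  where
  M D R S X Y : ℤ
  M = ↥ κ
  D = ↧ κ
  R = ↥ ρ
  S = ↧ ρ
  X = D ℤ.* S ℤ.* W ℤ.* (W ℤ.+ V)
  Y = M ℤ.* V ℤ.* (S ℤ.* W ℤ.+ R ℤ.* V)

  E : ℚ
  E = ι D * ι S * (ι V * ι V)

  E≢0 : E ≢ 0ℚ
  E≢0 = *-≢0 (*-≢0 (ι↧≢0 κ) (ι↧≢0 ρ)) (*-≢0 V≢0 V≢0)

  ιX : ι X ≡ E * (s * (s + 1ℚ))
  ιX = begin
    ι X
      ≡⟨ trans (ι-* (D ℤ.* S ℤ.* W) (W ℤ.+ V))
           (cong₂ _*_ (trans (ι-* (D ℤ.* S) W) (cong (_* ι W) (ι-* D S))) (ι-+ W V)) ⟩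
    ι D * ι S * ι W * (ι W + ι V)
      ≡⟨ cong (λ t → ι D * ι S * t * (t + ι V)) sV≡W ⟨
    ι D * ι S * (s * ι V) * (s * ι V + ι V)
      ≡⟨ solve 4 (λ d e s v → d :* e :* (s :* v) :* (s :* v :+ v)
                   := d :* e :* (v :* v) :* (s :* (s :+ con 1ℚ))) refl (ι D) (ι S) s (ι V) ⟩
    E * (s * (s + 1ℚ)) ∎

  ιY : ι Y ≡ E * (κ * (s + ρ))
  ιY = begin
    ι Y
      ≡⟨ trans (ι-* (M ℤ.* V) (S ℤ.* W ℤ.+ R ℤ.* V))
           (cong₂ _*_ (ι-* M V) (trans (ι-+ (S ℤ.* W) (R ℤ.* V)) (cong₂ _+_ (ι-* S W) (ι-* R V)))) ⟩
    ι M * ι V * (ι S * ι W + ι R * ι V)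
      ≡⟨ cong₂ (λ t r → t * ι V * (ι S * ι W + r * ι V)) (p*↧p≡↥p κ) (p*↧p≡↥p ρ) ⟨
    κ * ι D * ι V * (ι S * ι W + ρ * ι S * ι V)
      ≡⟨ cong (λ t → κ * ι D * ι V * (ι S * t + ρ * ι S * ι V)) sV≡W ⟨
    κ * ι D * ι V * (ι S * (s * ι V) + ρ * ι S * ι V)
      ≡⟨ solve 6 (λ d e s v κ ρ → κ :* d :* v :* (e :* (s :* v) :+ ρ :* e :* v)
                   := d :* e :* (v :* v) :* (κ :* (s :+ ρ))) refl (ι D) (ι S) s (ι V) κ ρ ⟩
    E * (κ * (s + ρ)) ∎

-- Since 2ⁿ divides `V` and `W` is odd, 2ⁿ divides the denominator of s = W/V, so `escape` applies.
quartic-point-outside : ∀ κ ρ → κ ≢ 0ℚ → Odd (↧ κ) → Odd (↧ ρ) →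
  ∀ L → ∃ λ s → s ∉ L × ∃ λ w → sq w ≡ sq (s * (s + 1ℚ)) + sq (κ * (s + ρ))
quartic-point-outside κ ρ κ≢0 D-odd S-odd L = s n , proj₂ escaping ,
  dehomogenise κ ρ (s n) (V (sol n)) (W (sol n)) (Z (sol n)) (ι≢0 (V≢0 (sol n))) (sV≡W n) (pythagoras (sol n))
  where
  open Solution

  sol : ∀ n → Solution (↥ κ) (↧ κ) (↥ ρ) (↧ ρ) n
  sol = solutions (↥ κ) (↧ κ) (↥ ρ) (↧ ρ) (κ≢0 ∘ ℚ.↥p≡0⇒p≡0 κ) D-odd S-odd

  s : ℕ → ℚ
  s n = ι (W (sol n)) ⊘ ι (V (sol n))

  sV≡W : ∀ n → s n * ι (V (sol n)) ≡ ι (W (sol n))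
  sV≡W n = ⊘-* (ι (W (sol n))) (ι≢0 (V≢0 (sol n)))

  escaping : ∃ λ n → s n ∉ L
  escaping = escape s (λ n → pow2∣denominator n {s n} {W (sol n)} {V (sol n)}
                               (sV≡W n) (W-odd (sol n)) (2ⁿ∣V (sol n))) L
  n = proj₁ escaping

-- Rational points on the conic.

-- X = 2tλ, κX + m = (1 − t²)λ, where t is an even multiple of the denominator of κ, so that m/X = W/V
-- with W odd.
conic-point-outside : ∀ κ m → m ≢ 0ℚ → ∀ L → ∃ λ X → X ∉ L × ∃ λ w → sq w ≡ sq X + sq (κ * X + m)
conic-point-outside κ m m≢0 L = X , X∉L , λ′ * (1ℚ + sq t) , (begin
    sq (λ′ * (1ℚ + sq t))
      ≡⟨ solve 2 (λ l t → l :* (con 1ℚ :+ t :* t) :* (l :* (con 1ℚ :+ t :* t))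
           := (t :+ t) :* l :* ((t :+ t) :* l) :+ l :* (con 1ℚ :- t :* t) :* (l :* (con 1ℚ :- t :* t))) refl λ′ t ⟩
    sq X + sq (λ′ * (1ℚ - sq t))
      ≡⟨ cong (λ y → sq X + sq y) Y≡κX+m ⟩
    sq X + sq (κ * X + m) ∎)
  where
  p q : ℤ
  p = ↥ κ
  q = ↧ κ

  T V W : ℕ → ℤ
  T n = pow2 (suc n) ℤ.* q
  V n = + 2 ℤ.* T n
  -- This is 1 - 2κT - T², an integer because `T` contains the denominator of `κ`.
  W n = + 1 ℤ.+ ℤ.-[1+ 1 ] ℤ.* (pow2 (suc n) ℤ.* p) ℤ.+ ℤ.-[1+ 0 ] ℤ.* (T n ℤ.* T n)

  T-even : ∀ n → + 2 ∣ T n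
  T-even n = ∣m⇒∣m*n q (pow2-suc-even n)

  W-odd : ∀ n → Odd (W n)
  W-odd n = odd+even (odd+even (odd 0ℤ) (∣n⇒∣m*n ℤ.-[1+ 1 ] (∣m⇒∣m*n p (pow2-suc-even n))))
              (∣n⇒∣m*n ℤ.-[1+ 0 ] (∣m⇒∣m*n (T n) (T-even n)))

  V≢0 : ∀ n → V n ≢ 0ℤ
  V≢0 n = ≢0-* {+ 2} (λ ()) (≢0-* {pow2 (suc n)} pow2≢0 (λ ()))
    where
    pow2≢0 : pow2 (suc n) ≢ 0ℤ
    pow2≢0 eq = ℕ.n≮0 (ℕ.≤-trans (n<2^n (suc n)) (ℕ.≤-reflexive (ℤ.+-injective eq)))

  s : ℕ → ℚ
  s n = ι (W n) ⊘ ι (V n)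

  sV≡W : ∀ n → s n * ι (V n) ≡ ι (W n)
  sV≡W n = ⊘-* (ι (W n)) (ι≢0 (V≢0 n))

  -- The growing denominators belong to m/X rather than X, so `L` is transported along X ↦ m/X.
  escaping : ∃ λ n → s n ∉ map (m ⊘_) L
  escaping = escape s (λ n → pow2∣denominator n {s n} {W n} {V n} (sV≡W n) (W-odd n)
    (∣n⇒∣m*n (+ 2) (∣m⇒∣m*n q (pow2∣pow2-suc n)))) (map (m ⊘_) L)

  n : ℕ
  n = proj₁ escaping

  t λ′ X : ℚ
  t = ι (T n)
  -- Obtained by solving κX + m = (1 - t²)λ with X = 2tλ.
  λ′ = m ⊘ ι (W n)
  X = (t + t) * λ′

  W≢0 : ι (W n) ≢ 0ℚ
  W≢0 = ι≢0 (odd≢0 (W-odd n))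

  ιV : ι (V n) ≡ t + t
  ιV = trans (ι-* (+ 2) (T n)) (solve 1 (λ t → (con 1ℚ :+ con 1ℚ) :* t := t :+ t) refl t)

  ιW : ι (W n) ≡ 1ℚ - κ * (t + t) - sq t
  ιW = begin
    ι (W n)
      ≡⟨ trans (ι-+ (+ 1 ℤ.+ ℤ.-[1+ 1 ] ℤ.* (N ℤ.* p)) (ℤ.-[1+ 0 ] ℤ.* (T n ℤ.* T n)))
           (cong₂ _+_ (trans (ι-+ (+ 1) (ℤ.-[1+ 1 ] ℤ.* (N ℤ.* p)))
               (cong (λ u → 1ℚ + u) (trans (ι-* ℤ.-[1+ 1 ] (N ℤ.* p)) (cong (ι ℤ.-[1+ 1 ] *_) (ι-* N p)))))
             (trans (ι-* ℤ.-[1+ 0 ] (T n ℤ.* T n)) (cong (ι ℤ.-[1+ 0 ] *_) (ι-* (T n) (T n))))) ⟩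
    1ℚ + ι ℤ.-[1+ 1 ] * (ι N * ι p) + ι ℤ.-[1+ 0 ] * sq t
      ≡⟨ cong (λ u → 1ℚ + ι ℤ.-[1+ 1 ] * (ι N * u) + ι ℤ.-[1+ 0 ] * sq t) (p*↧p≡↥p κ) ⟨
    1ℚ + ι ℤ.-[1+ 1 ] * (ι N * (κ * ι q)) + ι ℤ.-[1+ 0 ] * sq t
      ≡⟨ solve 4 (λ N k q t² → con 1ℚ :+ con (ι ℤ.-[1+ 1 ]) :* (N :* (k :* q)) :+ con (ι ℤ.-[1+ 0 ]) :* t²
           := con 1ℚ :- k :* (N :* q :+ N :* q) :- t²) refl (ι N) κ (ι q) (sq t) ⟩
    1ℚ - κ * (ι N * ι q + ι N * ι q) - sq t
      ≡⟨ cong (λ u → 1ℚ - κ * (u + u) - sq t) (ι-* N q) ⟨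
    1ℚ - κ * (t + t) - sq t ∎
    where
    N : ℤ
    N = pow2 (suc n)

  Y≡κX+m : λ′ * (1ℚ - sq t) ≡ κ * X + m
  Y≡κX+m = begin
    λ′ * (1ℚ - sq t)
      ≡⟨ solve 3 (λ l t k → l :* (con 1ℚ :- t :* t)
           := k :* ((t :+ t) :* l) :+ l :* (con 1ℚ :- k :* (t :+ t) :- t :* t)) refl λ′ t κ ⟩
    κ * X + λ′ * (1ℚ - κ * (t + t) - sq t)
      ≡⟨ cong (λ u → κ * X + λ′ * u) ιW ⟨
    κ * X + λ′ * ι (W n)
      ≡⟨ cong (λ u → κ * X + u) (⊘-* m W≢0) ⟩
    κ * X + m ∎

  sX≡m : s n * X ≡ m
  sX≡m = begin
    s n * ((t + t) * λ′)   ≡⟨ ℚ.*-assoc (s n) (t + t) λ′ ⟨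
    s n * (t + t) * λ′     ≡⟨ cong (λ u → s n * u * λ′) ιV ⟨
    s n * ι (V n) * λ′     ≡⟨ cong (_* λ′) (sV≡W n) ⟩
    ι (W n) * λ′           ≡⟨ ℚ.*-comm (ι (W n)) λ′ ⟩
    λ′ * ι (W n)           ≡⟨ ⊘-* m W≢0 ⟩
    m                      ∎

  X≢0 : X ≢ 0ℚ
  X≢0 = factor-≢0 X (s n) (trans (ℚ.*-comm X (s n)) sX≡m) m≢0

  X∉L : X ∉ L
  X∉L X∈L = proj₂ escaping (subst (_∈ map (m ⊘_) L) (sym (⊘-unique m X (s n) X≢0 sX≡m)) (∈-map⁺ (m ⊘_) X∈L))

-- Pairs of values of a single cubic fraction.

cubic : (α β γ x : ℚ) → ℚ
cubic α β γ x = (x + α) * (x + β) * (x + γ)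

-- `φ` and `ψ` are the values of `cubic`(x)/x at `x` and `u`, specified without division. Both
-- arguments avoid `L`, so that `invert` may exchange them.
record PairOutside (α β γ κ : ℚ) (L : List ℚ) : Set where
  field
    x u φ ψ z : ℚ
    x∉L : x ∉ L
    u∉L : u ∉ L
    x≢0 : x ≢ 0ℚ
    u≢0 : u ≢ 0ℚ
    φ≢0 : φ ≢ 0ℚ
    ψ≢0 : ψ ≢ 0ℚ
    φx  : φ * x ≡ cubic α β γ x
    ψu  : ψ * u ≡ cubic α β γ u
    z²  : sq z ≡ sq φ + sq (κ * ψ)

-- This lets any of the three parameters play the role of γ in x = γs.
permute : ∀ {α β γ α′ β′ γ′ κ L} → (∀ x → cubic α β γ x ≡ cubic α′ β′ γ′ x) →
  PairOutside α β γ κ L → PairOutside α′ β′ γ′ κ L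
permute perm P = record
  { x = x ; u = u ; φ = φ ; ψ = ψ ; z = z ; x∉L = x∉L ; u∉L = u∉L ; x≢0 = x≢0 ; u≢0 = u≢0
  ; φ≢0 = φ≢0 ; ψ≢0 = ψ≢0 ; φx = trans φx (perm x) ; ψu = trans ψu (perm u) ; z² = z² }
  where open PairOutside P

-- Multiplying the equation by κ² moves the multiplier to the other leg; exchanging `x` and `u`
-- restores the form.
invert : ∀ {α β γ κ κ′ L} → κ * κ′ ≡ 1ℚ → PairOutside α β γ κ′ L → PairOutside α β γ κ L
invert {κ = κ} {κ′} κκ′≡1 P = record
  { x = u ; u = x ; φ = ψ ; ψ = φ ; z = κ * z ; x∉L = u∉L ; u∉L = x∉L ; x≢0 = u≢0 ; u≢0 = x≢0
  ; φ≢0 = ψ≢0 ; ψ≢0 = φ≢0 ; φx = ψu ; ψu = φx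
  ; z² = begin
      sq (κ * z)                         ≡⟨ sq-scale z φ (κ′ * ψ) κ z² ⟩
      sq (κ * φ) + sq (κ * (κ′ * ψ))     ≡⟨ ℚ.+-comm (sq (κ * φ)) _ ⟩
      sq (κ * (κ′ * ψ)) + sq (κ * φ)     ≡⟨ cong (λ t → sq t + sq (κ * φ)) κκ′ψ≡ψ ⟩
      sq ψ + sq (κ * φ)                  ∎ }
  where
  open PairOutside P
  κκ′ψ≡ψ : κ * (κ′ * ψ) ≡ ψ
  κκ′ψ≡ψ = trans (sym (ℚ.*-assoc κ κ′ ψ)) (trans (cong (_* ψ) κκ′≡1) (ℚ.*-identityˡ ψ))

-- For x = γs and u = αβ/x the cubic fractions at x and u are C s(s+1) and C(s+ρ), C = (x+α)(x+β)/s².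
module _ {α β γ ρ s i j : ℚ} (iγ≡j : i * γ ≡ j) (js≡1 : j * s ≡ 1ℚ) (ργ²≡αβ : ρ * (γ * γ) ≡ α * β) where

  private
    x u : ℚ
    x = s * γ
    u = α * β * i

    ix≡1 : i * (s * γ) ≡ 1ℚ
    ix≡1 = begin
      i * (s * γ)  ≡⟨ solve 3 (λ i s g → i :* (s :* g) := i :* g :* s) refl i s γ ⟩
      i * γ * s    ≡⟨ cong (_* s) iγ≡j ⟩
      j * s        ≡⟨ js≡1 ⟩
      1ℚ           ∎

    -- `i` and `j` are 1/x and 1/s; inserting `i * x` puts a term over the denominator x.
    *ix : ∀ t → t ≡ t * (i * x)
    *ix t = sym (trans (cong (t *_) ix≡1) (ℚ.*-identityʳ t))

    -- The involution x ↦ αβ/x exchanges the zeros -α and -β; hence the fractions at x and u share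
    -- the factor (x + α)(x + β).
    u+ : ∀ α β → α * β * i + α ≡ α * i * (x + β)
    u+ α β = begin
      α * β * i + α              ≡⟨ cong (λ t → α * β * i + t) (*ix α) ⟩
      α * β * i + α * (i * x)    ≡⟨ solve 4 (λ a b i x → a :* b :* i :+ a :* (i :* x)
                                      := a :* i :* (x :+ b)) refl α β i x ⟩
      α * i * (x + β)            ∎

    u+γ : u + γ ≡ i * (γ * γ) * (s + ρ)
    u+γ = begin
      α * β * i + γ                        ≡⟨ cong₂ (λ t g → t * i + g) (sym ργ²≡αβ) (*ix γ) ⟩
      ρ * (γ * γ) * i + γ * (i * (s * γ))  ≡⟨ solve 4 (λ r g i s → r :* (g :* g) :* i :+ g :* (i :* (s :* g))
                                                := i :* (g :* g) :* (s :+ r)) refl ρ γ i s ⟩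
      i * (γ * γ) * (s + ρ)                ∎

  cubic-at-x : (x + α) * (x + β) * (j * j) * (s * (s + 1ℚ)) * x ≡ cubic α β γ x
  cubic-at-x = begin
    (x + α) * (x + β) * (j * j) * (s * (s + 1ℚ)) * (s * γ)
      ≡⟨ solve 4 (λ n j s g → n :* (j :* j) :* (s :* (s :+ con 1ℚ)) :* (s :* g)
           := n :* (j :* s :* (j :* s) :* (s :* g :+ g))) refl ((x + α) * (x + β)) j s γ ⟩
    (x + α) * (x + β) * (j * s * (j * s) * (x + γ))
      ≡⟨ cong (λ t → (x + α) * (x + β) * (t * t * (x + γ))) js≡1 ⟩
    (x + α) * (x + β) * (1ℚ * 1ℚ * (x + γ))
      ≡⟨ cong ((x + α) * (x + β) *_) (ℚ.*-identityˡ (x + γ)) ⟩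
    (x + α) * (x + β) * (x + γ) ∎

  cubic-at-u : (x + α) * (x + β) * (j * j) * (s + ρ) * u ≡ cubic α β γ u
  cubic-at-u = sym (begin
    (u + α) * (u + β) * (u + γ)
      ≡⟨ cong₂ _*_ (cong₂ _*_ (u+ α β) (trans (cong (λ t → t * i + β) (ℚ.*-comm α β)) (u+ β α))) u+γ ⟩
    α * i * (x + β) * (β * i * (x + α)) * (i * (γ * γ) * (s + ρ))
      ≡⟨ solve 7 (λ a b i x+a x+b g t → a :* i :* x+b :* (b :* i :* x+a) :* (i :* (g :* g) :* t)
           := x+a :* x+b :* (i :* g :* (i :* g)) :* t :* (a :* b :* i)) refl α β i (x + α) (x + β) γ (s + ρ) ⟩
    (x + α) * (x + β) * (i * γ * (i * γ)) * (s + ρ) * u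
      ≡⟨ cong (λ t → (x + α) * (x + β) * (t * t) * (s + ρ) * u) iγ≡j ⟩
    (x + α) * (x + β) * (j * j) * (s + ρ) * u ∎)

-- The values of s at which x, `φ` or `ψ` would vanish.
degenerate : (α β γ ρ : ℚ) → List ℚ
degenerate α β γ ρ = 0ℚ ∷ - 1ℚ ∷ - ρ ∷ (- α) ⊘ γ ∷ (- β) ⊘ γ ∷ []

-- Besides the degenerate values, `L` is pulled back along x = γs and along u = αβ/(γs).
excluded : (α β γ ρ : ℚ) → List ℚ → List ℚ
excluded α β γ ρ L = degenerate α β γ ρ ++ map (_⊘ γ) L ++ map (λ l → (α * β) ⊘ (l * γ)) L

pair-from-point : ∀ α β γ κ ρ L → α ≢ 0ℚ → β ≢ 0ℚ → γ ≢ 0ℚ → ρ * (γ * γ) ≡ α * β →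
  (∃ λ s → s ∉ excluded α β γ ρ L × ∃ λ w → sq w ≡ sq (s * (s + 1ℚ)) + sq (κ * (s + ρ))) →
  PairOutside α β γ κ L
pair-from-point α β γ κ ρ L α≢0 β≢0 γ≢0 ργ²≡αβ (s , s∉ , w , w²) = record
  { x = x ; u = u ; φ = C * (s * (s + 1ℚ)) ; ψ = C * (s + ρ) ; z = C * w
  ; x∉L = λ x∈L → s∉ (∈-++⁺ʳ (degenerate α β γ ρ) (∈-++⁺ˡ
      (subst (_∈ map (_⊘ γ) L) (sym (⊘-unique x γ s γ≢0 refl)) (∈-map⁺ (_⊘ γ) x∈L))))
  ; u∉L = λ u∈L → s∉ (∈-++⁺ʳ (degenerate α β γ ρ) (∈-++⁺ʳ (map (_⊘ γ) L)
      (subst (_∈ map back L) (sym (⊘-unique (α * β) (u * γ) s (*-≢0 u≢0 γ≢0) suγ≡αβ)) (∈-map⁺ back u∈L))))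
  ; x≢0 = x≢0
  ; u≢0 = u≢0
  ; φ≢0 = *-≢0 C≢0 (*-≢0 s≢0 (+-≢0 s 1ℚ (λ eq → s∉ (there (here eq)))))
  ; ψ≢0 = *-≢0 C≢0 (+-≢0 s ρ (λ eq → s∉ (there (there (here eq)))))
  ; φx = cubic-at-x {ρ = ρ} {s} {i} {j} iγ≡j js≡1 ργ²≡αβ
  ; ψu = cubic-at-u {ρ = ρ} {s} {i} {j} iγ≡j js≡1 ργ²≡αβ
  -- `C` is the common factor of `φ` and `ψ`, so the equation for `w` is scaled by it.
  ; z² = trans (sq-scale w (s * (s + 1ℚ)) (κ * (s + ρ)) C w²) (cong (λ t → sq (C * (s * (s + 1ℚ))) + sq t)
           (solve 3 (λ c k t → c :* (k :* t) := k :* (c :* t)) refl C κ (s + ρ)))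
  }
  where
  back : ℚ → ℚ
  back l = (α * β) ⊘ (l * γ)

  x j i u C : ℚ
  x = s * γ
  j = 1ℚ ⊘ s
  i = 1ℚ ⊘ x
  u = α * β * i
  C = (x + α) * (x + β) * (j * j)

  s≢0 : s ≢ 0ℚ
  s≢0 eq = s∉ (here eq)

  x≢0 : x ≢ 0ℚ
  x≢0 = *-≢0 s≢0 γ≢0

  js≡1 : j * s ≡ 1ℚ
  js≡1 = ⊘-* 1ℚ s≢0

  ix≡1 : i * x ≡ 1ℚ
  ix≡1 = ⊘-* 1ℚ x≢0

  iγ≡j : i * γ ≡ j
  iγ≡j = *-cancelʳ (i * γ) j s≢0
    (trans (trans (ℚ.*-assoc i γ s) (cong (i *_) (ℚ.*-comm γ s))) (trans ix≡1 (sym js≡1)))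

  u≢0 : u ≢ 0ℚ
  u≢0 = *-≢0 (*-≢0 α≢0 β≢0) (factor-≢0 i x ix≡1 ℚ.1≢0)

  C≢0 : C ≢ 0ℚ
  C≢0 = *-≢0 (*-≢0 (+-≢0 x α (λ eq → s∉ (there (there (there (here (⊘-unique (- α) γ s γ≢0 eq)))))))
                    (+-≢0 x β (λ eq → s∉ (there (there (there (there (here (⊘-unique (- β) γ s γ≢0 eq)))))))))
             (*-≢0 j≢0 j≢0)
    where
    j≢0 : j ≢ 0ℚ
    j≢0 = factor-≢0 j s js≡1 ℚ.1≢0

  suγ≡αβ : s * (u * γ) ≡ α * β
  suγ≡αβ = begin
    s * (α * β * i * γ)    ≡⟨ solve 4 (λ s t i g → s :* (t :* i :* g) := t :* (i :* (s :* g))) refl s (α * β) i γ ⟩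
    α * β * (i * x)        ≡⟨ cong (α * β *_) ix≡1 ⟩
    α * β * 1ℚ             ≡⟨ ℚ.*-identityʳ (α * β) ⟩
    α * β                  ∎

pair-odd-ρ-odd-κ : ∀ α β γ κ ρ → α ≢ 0ℚ → β ≢ 0ℚ → γ ≢ 0ℚ → κ ≢ 0ℚ → Odd (↧ κ) →
  ρ * (γ * γ) ≡ α * β → Odd (↧ ρ) → ∀ L → PairOutside α β γ κ L
pair-odd-ρ-odd-κ α β γ κ ρ α≢0 β≢0 γ≢0 κ≢0 κ-odd ργ²≡αβ ρ-odd L =
  pair-from-point α β γ κ ρ L α≢0 β≢0 γ≢0 ργ²≡αβ (quartic-point-outside κ ρ κ≢0 κ-odd ρ-odd (excluded α β γ ρ L))

-- Only the first coordinate is kept away from a list; this already separates triples.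
record Outside (L : List ℚ) (F G : ℚ → ℚ) : Set where
  constructor outside
  field
    x y z : ℚ
    x∉L : x ∉ L
    F≢0 : F x ≢ 0ℚ
    G≢0 : G y ≢ 0ℚ
    z²  : sq z ≡ sq (F x) + sq (G y)

infinitelyMany : ∀ {F G} → (∀ L → Outside L F G) → InfinitelyMany (NontrivPlus F G)
infinitelyMany {F} {G} sols L with sols (map proj₁ L)
... | outside x y z x∉L F≢0 G≢0 z² =
  (x , y , z) , (z² , *-≢0 F≢0 G≢0 , pythagorean-legs-differ (F x) (G y) z F≢0 z²) ,
  λ t∈L → x∉L (∈-map⁺ proj₁ t∈L)

-- Reduction to ρ and κ with odd denominators.

ratio : ℚ → ℚ → ℚ → ℚ
ratio α β γ = (α * β) ⊘ (γ * γ)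

-- `ratio α β γ` is the ρ that belongs to x = γs. By `odd-denominator`, some cyclic order of the
-- parameters then gives a ρ with odd denominator.
ratio-cycle : ∀ {α β γ} → α ≢ 0ℚ → β ≢ 0ℚ → γ ≢ 0ℚ → ratio α β γ * ratio β γ α * ratio γ α β ≡ 1ℚ
ratio-cycle {α} {β} {γ} α≢0 β≢0 γ≢0 = *-cancelʳ (ratio α β γ * ratio β γ α * ratio γ α β) 1ℚ
  (*-≢0 (*-≢0 (*-≢0 γ≢0 γ≢0) (*-≢0 α≢0 α≢0)) (*-≢0 β≢0 β≢0)) (begin
    ratio α β γ * ratio β γ α * ratio γ α β * (γ * γ * (α * α) * (β * β))
      ≡⟨ solve 6 (λ p q r a b c → p :* q :* r :* (c :* a :* b) := (p :* c) :* (q :* a) :* (r :* b)) refl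
           (ratio α β γ) (ratio β γ α) (ratio γ α β) (α * α) (β * β) (γ * γ) ⟩
    (ratio α β γ * (γ * γ)) * (ratio β γ α * (α * α)) * (ratio γ α β * (β * β))
      ≡⟨ cong₂ _*_ (cong₂ _*_ (⊘-* (α * β) (*-≢0 γ≢0 γ≢0)) (⊘-* (β * γ) (*-≢0 α≢0 α≢0)))
           (⊘-* (γ * α) (*-≢0 β≢0 β≢0)) ⟩
    (α * β) * (β * γ) * (γ * α)
      ≡⟨ solve 3 (λ a b c → (a :* b) :* (b :* c) :* (c :* a)
           := con 1ℚ :* (c :* c :* (a :* a) :* (b :* b))) refl α β γ ⟩
    1ℚ * (γ * γ * (α * α) * (β * β)) ∎)

pair-odd-κ : ∀ α β γ κ → α ≢ 0ℚ → β ≢ 0ℚ → γ ≢ 0ℚ → κ ≢ 0ℚ → Odd (↧ κ) → ∀ L → PairOutside α β γ κ L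
pair-odd-κ α β γ κ α≢0 β≢0 γ≢0 κ≢0 κ-odd L = by-parity
  (odd-denominator {ratio α β γ} {ratio β γ α} {ratio γ α β} (ratio-cycle α≢0 β≢0 γ≢0))
  where
  by-parity : Odd (↧ (ratio α β γ)) ⊎ Odd (↧ (ratio β γ α)) ⊎ Odd (↧ (ratio γ α β)) → PairOutside α β γ κ L
  by-parity (inj₁ o) =
    pair-odd-ρ-odd-κ α β γ κ (ratio α β γ) α≢0 β≢0 γ≢0 κ≢0 κ-odd (⊘-* (α * β) (*-≢0 γ≢0 γ≢0)) o L
  by-parity (inj₂ (inj₁ o)) = permute
    (λ x → solve 3 (λ a b c → b :* c :* a := a :* b :* c) refl (x + α) (x + β) (x + γ))
    (pair-odd-ρ-odd-κ β γ α κ (ratio β γ α) β≢0 γ≢0 α≢0 κ≢0 κ-odd (⊘-* (β * γ) (*-≢0 α≢0 α≢0)) o L)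
  by-parity (inj₂ (inj₂ o)) = permute
    (λ x → solve 3 (λ a b c → c :* a :* b := a :* b :* c) refl (x + α) (x + β) (x + γ))
    (pair-odd-ρ-odd-κ γ α β κ (ratio γ α β) γ≢0 α≢0 β≢0 κ≢0 κ-odd (⊘-* (γ * α) (*-≢0 β≢0 β≢0)) o L)

pair : ∀ α β γ κ → α ≢ 0ℚ → β ≢ 0ℚ → γ ≢ 0ℚ → κ ≢ 0ℚ → ∀ L → PairOutside α β γ κ L
pair α β γ κ α≢0 β≢0 γ≢0 κ≢0 L = by-parity (numerator-or-denominator-odd κ)
  where
  κκ⁻¹≡1 : κ * (1ℚ ⊘ κ) ≡ 1ℚ
  κκ⁻¹≡1 = trans (ℚ.*-comm κ (1ℚ ⊘ κ)) (⊘-* 1ℚ κ≢0)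

  κ⁻¹↥κ≡↧κ : (1ℚ ⊘ κ) * ι (↥ κ) ≡ ι (↧ κ)
  κ⁻¹↥κ≡↧κ = begin
    (1ℚ ⊘ κ) * ι (↥ κ)         ≡⟨ cong ((1ℚ ⊘ κ) *_) (p*↧p≡↥p κ) ⟨
    (1ℚ ⊘ κ) * (κ * ι (↧ κ))   ≡⟨ ℚ.*-assoc (1ℚ ⊘ κ) κ (ι (↧ κ)) ⟨
    (1ℚ ⊘ κ) * κ * ι (↧ κ)     ≡⟨ cong (_* ι (↧ κ)) (⊘-* 1ℚ κ≢0) ⟩
    1ℚ * ι (↧ κ)               ≡⟨ ℚ.*-identityˡ (ι (↧ κ)) ⟩
    ι (↧ κ)                    ∎

  -- Cross-multiplication gives `↥ κ⁻¹ * ↥ κ ≡ ↧ κ * ↧ κ⁻¹`; an even denominator of κ⁻¹ would make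
  -- the left side odd and the right side even.
  inverse-odd : Odd (↥ κ) → Odd (↧ (1ℚ ⊘ κ))
  inverse-odd o with parity (↧ (1ℚ ⊘ κ)) | numerator-or-denominator-odd (1ℚ ⊘ κ)
  ... | inj₂ o′ | _ = o′
  ... | inj₁ _  | inj₂ o′ = o′
  ... | inj₁ e  | inj₁ o′ = ⊥-elim (odd⇒¬even (odd-* o′ o)
          (subst (+ 2 ∣_) (sym (cross-multiply {1ℚ ⊘ κ} {↧ κ} {↥ κ} κ⁻¹↥κ≡↧κ)) (∣n⇒∣m*n (↧ κ) e)))

  by-parity : Odd (↥ κ) ⊎ Odd (↧ κ) → PairOutside α β γ κ L
  by-parity (inj₂ o) = pair-odd-κ α β γ κ α≢0 β≢0 γ≢0 κ≢0 o L
  by-parity (inj₁ o) = invert κκ⁻¹≡1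
    (pair-odd-κ α β γ (1ℚ ⊘ κ) α≢0 β≢0 γ≢0 (factor-≢0 (1ℚ ⊘ κ) κ (⊘-* 1ℚ κ≢0) ℚ.1≢0) (inverse-odd o) L)

-- The cases e = kb and e ≠ kb, and the theorem.

fraction : (a b c : ℚ) → ℚ → ℚ
fraction a b c x = cubic a b c x ⊘ x

-- Scaling argument and zeros by k multiplies the cubic fraction by k², whence the multiplier
-- `k * k`.
outside-from-pair : ∀ a b c k L → k ≢ 0ℚ → PairOutside a b c (k * k) L →
  Outside L (fraction a b c) (fraction (k * a) (k * b) (k * c))
outside-from-pair a b c k L k≢0 P = record
  { x = x ; y = k * u ; z = z ; x∉L = x∉L
  ; F≢0 = subst (_≢ 0ℚ) F≡φ φ≢0
  ; G≢0 = subst (_≢ 0ℚ) G≡κψ (*-≢0 (*-≢0 k≢0 k≢0) ψ≢0)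
  ; z² = trans z² (cong₂ (λ s t → sq s + sq t) F≡φ G≡κψ)
  }
  where
  open PairOutside P
  F≡φ : φ ≡ fraction a b c x
  F≡φ = ⊘-unique (cubic a b c x) x φ x≢0 φx
  G≡κψ : k * k * ψ ≡ fraction (k * a) (k * b) (k * c) (k * u)
  G≡κψ = ⊘-unique (cubic (k * a) (k * b) (k * c) (k * u)) (k * u) (k * k * ψ) (*-≢0 k≢0 u≢0) (begin
    k * k * ψ * (k * u)
      ≡⟨ solve 3 (λ k p u → k :* k :* p :* (k :* u) := k :* k :* k :* (p :* u)) refl k ψ u ⟩
    k * k * k * (ψ * u)
      ≡⟨ cong (k * k * k *_) ψu ⟩
    k * k * k * ((u + a) * (u + b) * (u + c))
      ≡⟨ solve 5 (λ k u a b c → k :* k :* k :* ((u :+ a) :* (u :+ b) :* (u :+ c))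
           := (k :* u :+ k :* a) :* (k :* u :+ k :* b) :* (k :* u :+ k :* c)) refl k u a b c ⟩
    cubic (k * a) (k * b) (k * c) (k * u) ∎)

-- Along y = kx, the zeros of g lie at -a, -c and -e/k, so one new entry joins those of f.
zeros-and-pole : (a b c e k : ℚ) → List ℚ
zeros-and-pole a b c e k = 0ℚ ∷ - a ∷ - b ∷ - c ∷ (- e) ⊘ k ∷ []

-- With X = x + b and `Q` the shared factor, f(x) = QX and g(kx) = Q(k²X + k(e - kb)). The forbidden
-- values of x are shifted by `b` to values of X.
outside-from-conic : ∀ a b c e k L → k ≢ 0ℚ →
  (∃ λ X → X ∉ map (_+ b) (zeros-and-pole a b c e k ++ L) ×
    ∃ λ w → sq w ≡ sq X + sq (k * k * X + k * (e - k * b))) →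
  Outside L (fraction a b c) (fraction (k * a) e (k * c))
outside-from-conic a b c e k L k≢0 (X , X∉ , w , w²) = record
  { x = x ; y = k * x ; z = Q * w
  ; x∉L = λ x∈L → x∉ (∈-++⁺ʳ (zeros-and-pole a b c e k) x∈L)
  ; F≢0 = subst (_≢ 0ℚ) F≡ (*-≢0 Q≢0 X≢0)
  ; G≢0 = subst (_≢ 0ℚ) G≡ (*-≢0 Q≢0 Y≢0)
  ; z² = trans (sq-scale w X (k * k * X + m) Q w²) (cong₂ (λ s t → sq s + sq t) F≡ G≡)
  }
  where
  m x i Q : ℚ
  m = k * (e - k * b)
  x = X - b
  i = 1ℚ ⊘ x
  Q = (x + a) * (x + c) * i

  x+b≡X : x + b ≡ X
  x+b≡X = solve 2 (λ X b → X :- b :+ b := X) refl X b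

  x∉ : x ∉ zeros-and-pole a b c e k ++ L
  x∉ x∈ = X∉ (subst (_∈ map (_+ b) (zeros-and-pole a b c e k ++ L)) x+b≡X (∈-map⁺ (_+ b) x∈))

  x≢0 : x ≢ 0ℚ
  x≢0 eq = x∉ (here eq)

  ix≡1 : i * x ≡ 1ℚ
  ix≡1 = ⊘-* 1ℚ x≢0

  Q≢0 : Q ≢ 0ℚ
  Q≢0 = *-≢0 (*-≢0 (+-≢0 x a (λ eq → x∉ (there (here eq))))
                    (+-≢0 x c (λ eq → x∉ (there (there (there (here eq)))))))
             (factor-≢0 i x ix≡1 ℚ.1≢0)

  X≢0 : X ≢ 0ℚ
  X≢0 = subst (_≢ 0ℚ) x+b≡X (+-≢0 x b (λ eq → x∉ (there (there (here eq)))))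

  Y≡ : k * k * X + m ≡ k * (x * k + e)
  Y≡ = solve 4 (λ k X e b → k :* k :* X :+ k :* (e :- k :* b) := k :* ((X :- b) :* k :+ e)) refl k X e b

  Y≢0 : k * k * X + m ≢ 0ℚ
  Y≢0 = subst (_≢ 0ℚ) (sym Y≡) (*-≢0 k≢0 (+-≢0 (x * k) e (λ eq → x∉ (there (there (there (there
          (here (⊘-unique (- e) k x k≢0 eq)))))))))

  F≡ : Q * X ≡ fraction a b c x
  F≡ = ⊘-unique (cubic a b c x) x (Q * X) x≢0 (begin
    (x + a) * (x + c) * i * X * x
      ≡⟨ solve 5 (λ s t i X x → s :* t :* i :* X :* x := s :* X :* t :* (i :* x)) refl (x + a) (x + c) i X x ⟩
    (x + a) * X * (x + c) * (i * x)
      ≡⟨ trans (cong ((x + a) * X * (x + c) *_) ix≡1) (ℚ.*-identityʳ _) ⟩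
    (x + a) * X * (x + c)
      ≡⟨ cong (λ t → (x + a) * t * (x + c)) x+b≡X ⟨
    (x + a) * (x + b) * (x + c) ∎)

  G≡ : Q * (k * k * X + m) ≡ fraction (k * a) e (k * c) (k * x)
  G≡ = ⊘-unique (cubic (k * a) e (k * c) (k * x)) (k * x) (Q * (k * k * X + m)) (*-≢0 k≢0 x≢0) (begin
    (x + a) * (x + c) * i * (k * k * X + m) * (k * x)
      ≡⟨ cong (λ t → (x + a) * (x + c) * i * t * (k * x)) Y≡ ⟩
    (x + a) * (x + c) * i * (k * (x * k + e)) * (k * x)
      ≡⟨ solve 6 (λ x a c i k e → (x :+ a) :* (x :+ c) :* i :* (k :* (x :* k :+ e)) :* (k :* x)
           := (k :* x :+ k :* a) :* (k :* x :+ e) :* (k :* x :+ k :* c) :* (i :* x)) refl x a c i k e ⟩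
    cubic (k * a) e (k * c) (k * x) * (i * x)
      ≡⟨ trans (cong (cubic (k * a) e (k * c) (k * x) *_) ix≡1) (ℚ.*-identityʳ _) ⟩
    cubic (k * a) e (k * c) (k * x) ∎)

pythagorean-pairs : ∀ a b c e k → a ≢ 0ℚ → b ≢ 0ℚ → c ≢ 0ℚ → k ≢ 0ℚ →
  ∀ L → Outside L (fraction a b c) (fraction (k * a) e (k * c))
pythagorean-pairs a b c e k a≢0 b≢0 c≢0 k≢0 L with e ℚ.≟ k * b
... | yes refl = outside-from-pair a b c k L k≢0 (pair a b c (k * k) a≢0 b≢0 c≢0 (*-≢0 k≢0 k≢0) L)
... | no e≢kb = outside-from-conic a b c e k L k≢0
        (conic-point-outside (k * k) (k * (e - k * b)) (*-≢0 k≢0 e-kb≢0) (map (_+ b) (zeros-and-pole a b c e k ++ L)))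
  where
  e-kb≢0 : e - k * b ≢ 0ℚ
  e-kb≢0 eq = e≢kb (trans (solve 2 (λ e t → e := (e :- t) :+ t) refl e (k * b))
    (trans (cong (_+ k * b) eq) (ℚ.+-identityˡ (k * b))))

theorem1p3 : (a b c d e : ℤ) → a ≢ 0ℤ → b ≢ 0ℤ → c ≢ 0ℤ → d ≢ 0ℤ → e ≢ 0ℤ →
    InfinitelyMany (NontrivPlus (fF a b c) (gF a c d e))
    ⊎ InfinitelyMany (NontrivMinus (fF a b c) (gF a c d e))
theorem1p3 a b c d e a≢0 b≢0 c≢0 d≢0 e≢0 = inj₁ (infinitelyMany λ L →
  subst₂ (λ s t → Outside L (fF a b c) (fraction s (ι e) t)) ka≡d kc≡cd/a
    (pythagorean-pairs (ι a) (ι b) (ι c) (ι e) k (ι≢0 a≢0) (ι≢0 b≢0) (ι≢0 c≢0) k≢0 L))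
  where
  k : ℚ
  k = ι d ⊘ ι a

  ka≡d : k * ι a ≡ ι d
  ka≡d = ⊘-* (ι d) (ι≢0 a≢0)

  k≢0 : k ≢ 0ℚ
  k≢0 = factor-≢0 k (ι a) ka≡d (ι≢0 d≢0)

  kc≡cd/a : k * ι c ≡ (ι c * ι d) ⊘ ι a
  kc≡cd/a = ⊘-unique (ι c * ι d) (ι a) (k * ι c) (ι≢0 a≢0) (begin
    k * ι c * ι a    ≡⟨ solve 3 (λ k c a → k :* c :* a := c :* (k :* a)) refl k (ι c) (ι a) ⟩
    ι c * (k * ι a)  ≡⟨ cong (ι c *_) ka≡d ⟩
    ι c * ι d        ∎)
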